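{- For every integer $k \ge 3$, there exists a graph $G$ such that $G \nrightarrow K_{k}$ and $G \rightarrow (K_{s},K_{k-1})$, where $s=R(k)-1$.
   Context: For positive integers $a,b$ and a graph $G$, we write $G \rightarrow (K_a,K_b)$ if every colouring of the edges of $G$ with red and blue contains a red copy of $K_a$ or a blue copy of $K_b$, and $G\nrightarrow (K_a,K_b)$ otherwise. We write $G\rightarrow K_k$ for $G\rightarrow (K_k,K_k)$. The Ramsey number $R(k)$ is the minimum $n$ such that $K_n \rightarrow K_k$. -}

module Defs where

open import Data.Nat using (ℕ; _<_)
open import Data.Empty using (⊥-elim)
open import Data.Fin using (Fin)
open import Data.Fin.Properties using (_≟_)
open import Data.Bool using (Bool; true; false; not)
open import Data.Product using (Σ; _×_; ∃)
open import Data.Sum using (_⊎_)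
open import Relation.Nullary using (¬_; does; yes; no)
open import Relation.Binary.PropositionalEquality using (_≡_; _≢_; refl; sym)
open import Function.Definitions using (Injective)

record Graph (n : ℕ) : Set where
  field
    adj   : Fin n → Fin n → Bool
    adjSym : ∀ i j → adj i j ≡ adj j i
    adjIrr : ∀ i → adj i i ≡ false
open Graph public

K : (n : ℕ) → Graph n
K n = record
  { adj   = λ i j → not (does (i ≟ j))
  ; adjSym = symAdj
  ; adjIrr = irrAdj }
  where
  symAdj : ∀ i j → not (does (i ≟ j)) ≡ not (does (j ≟ i))
  symAdj i j with i ≟ j | j ≟ i
  ... | yes _ | yes _ = refl
  ... | no _  | no _  = refl
  ... | yes p | no q  = ⊥-elim (q (sym p))
  ... | no p  | yes q = ⊥-elim (p (sym q))
  irrAdj : ∀ i → not (does (i ≟ i)) ≡ false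
  irrAdj i with i ≟ i
  ... | yes _ = refl
  ... | no ¬p = ⊥-elim (¬p refl)

data Colour : Set where
  red blue : Colour

-- A red/blue colouring of the edges of G: a symmetric colour assignment
-- to pairs of vertices (only its values on edges of G matter).
record Colouring {n : ℕ} (G : Graph n) : Set where
  field
    col    : Fin n → Fin n → Colour
    colSym : ∀ i j → col i j ≡ col j i
open Colouring public

MonoClique : ∀ {n} (G : Graph n) → Colouring G → Colour → ℕ → Set
MonoClique {n} G χ c a =
  Σ (Fin a → Fin n) λ f →
    Injective _≡_ _≡_ f ×
    (∀ i j → i ≢ j → (adj G (f i) (f j) ≡ true) × (col χ (f i) (f j) ≡ c))

Arrows : ∀ {n} → Graph n → ℕ → ℕ → Set
Arrows G a b = ∀ (χ : Colouring G) → MonoClique G χ red a ⊎ MonoClique G χ blue b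

NotArrows : ∀ {n} → Graph n → ℕ → ℕ → Set
NotArrows G a b =
  Σ (Colouring G) λ χ → ¬ MonoClique G χ red a × ¬ MonoClique G χ blue b

IsRamseyNumber : ℕ → ℕ → Set
IsRamseyNumber k r = Arrows (K r) k k × (∀ m → m < r → ¬ Arrows (K m) k k)

{-# OPTIONS --safe #-}
module Submission where

-- A partite construction (Nešetřil–Rödl) for 2-edge-coloured graphs without a
-- monochromatic K_k.  Take as seed A the disjoint union of a good colouring of
-- K_s and of a red and a blue K_{k-1}.  There is a coloured graph B, again
-- without a monochromatic K_k, such that every recolouring χ of B is, on some
-- copy of A, a function η of the original colour.  If η takes the value blue, a
-- blue K_{k-1} appears; otherwise the copy of K_s is entirely red.
--
-- B is obtained by making χ constant on the edges of one given colour, once for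
-- each colour.  To that end, start with copies of A laid out over N parts along
-- all sequences of parts, and for each pair of parts replace the edges between
-- them by a power, in which the Hales–Jewett theorem finds a combinatorial line
-- where χ is constant.  Then χ depends only on the pair of parts, and Ramsey's
-- theorem for N selects a copy of A.

open import Defs
open import Data.Bool using (Bool; true; false; not; if_then_else_; _∨_)
open import Data.Bool.Properties using (∨-zeroʳ)
open import Data.Empty using (⊥; ⊥-elim)
open import Data.Fin as Fin using (Fin; zero; suc; _↑ˡ_; _↑ʳ_)
open import Data.Fin.Properties as Fin using (any?; all?; pigeonhole; remQuot-combine; splitAt-join)
open import Data.List as List using (List; []; _∷_; length; filter; cartesianProduct; allFin)
open import Data.List.Membership.Propositional using (_∈_)
open import Data.List.Membership.Propositional.Properties using (∈-filter⁺; ∈-filter⁻; ∈-lookup; ∈-allFin; ∈-cartesianProduct⁺; ∈-map⁺)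
open import Data.List.Relation.Unary.All as All using (All; []; _∷_)
open import Data.List.Relation.Unary.AllPairs using ([]; _∷_)
open import Data.List.Relation.Unary.AllPairs.Properties using () renaming (filter⁺ to AllPairs-filter⁺)
open import Data.List.Relation.Unary.Any using (here; there; index)
open import Data.List.Relation.Unary.Any.Properties using (lookup-index)
open import Data.List.Relation.Unary.Unique.Propositional using (Unique)
open import Data.List.Relation.Unary.Unique.Propositional.Properties using (allFin⁺)
open import Data.List.Properties using (length-tabulate)
open import Data.Maybe as Maybe using (Maybe; just; nothing; maybe; fromMaybe)
open import Data.Nat using (ℕ; zero; suc; _+_; _*_; _≤_; _<_; _∸_; z≤n; s≤s)
open import Data.Nat.Properties as ℕ using (≤-reflexive; n<1+n)
open import Data.Product as Product using (Σ; _×_; _,_; ∃; proj₁; proj₂)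
open import Data.Sum as Sum using (_⊎_; inj₁; inj₂; [_,_])
open import Data.Vec using (Vec; []; _∷_; _++_; map; lookup; tabulate)
open import Data.Vec.Properties using (map-++; map-cong; map-∘; map-id; lookup-map; lookup-++ˡ; lookup-++ʳ; lookup∘tabulate)
open import Function using (_∘_; id; mk⇔)
open import Relation.Binary.Definitions using (DecidableEquality; tri<; tri≈; tri>)
open import Relation.Binary.PropositionalEquality using (_≡_; _≢_; refl; sym; trans; cong; cong₂; subst; subst₂)
open import Relation.Nullary using (¬_; Dec; yes; no; does; contradiction)
open import Relation.Nullary.Decidable using (map′; _×-dec_; _⊎-dec_; _→-dec_; ¬?; does-⇔; dec-true; dec-false)
open import Relation.Unary using (Decidable)

-- Finite types

-- Only a retract of Fin size: decode may repeat elements.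
record Finite (A : Set) : Set where
  field
    size          : ℕ
    encode        : A → Fin size
    decode        : Fin size → A
    decode-encode : ∀ a → decode (encode a) ≡ a

  encode-injective : ∀ {a b} → encode a ≡ encode b → a ≡ b
  encode-injective {a} {b} eq =
    trans (sym (decode-encode a)) (trans (cong decode eq) (decode-encode b))

  _≟ᶠ_ : DecidableEquality A
  a ≟ᶠ b = map′ encode-injective (cong encode) (encode a Fin.≟ encode b)

  ∃? : {P : A → Set} → Decidable P → Dec (∃ P)
  ∃? {P} P? = map′ (λ (i , p) → decode i , p)
                   (λ (a , p) → encode a , subst P (sym (decode-encode a)) p)
                   (any? (P? ∘ decode))

  elements : List A
  elements = List.map decode (allFin size)

  ∈-elements : ∀ a → a ∈ elements
  ∈-elements a = subst (_∈ elements) (decode-encode a) (∈-map⁺ decode (∈-allFin (encode a)))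

open Finite

Fin-finite : ∀ n → Finite (Fin n)
Fin-finite n = record { size = n ; encode = id ; decode = id ; decode-encode = λ _ → refl }

Bool-finite : Finite Bool
Bool-finite = record
  { size = 2
  ; encode = λ b → if b then zero else suc zero
  ; decode = λ { zero → true ; (suc _) → false }
  ; decode-encode = λ { true → refl ; false → refl } }

Colour-finite : Finite Colour
Colour-finite = record
  { size = 2
  ; encode = λ { red → zero ; blue → suc zero }
  ; decode = λ { zero → red ; (suc _) → blue }
  ; decode-encode = λ { red → refl ; blue → refl } }

Maybe-finite : ∀ {A} → Finite A → Finite (Maybe A)
Maybe-finite F = record
  { size = suc (size F)
  ; encode = maybe (suc ∘ encode F) zero
  ; decode = λ { zero → nothing ; (suc i) → just (decode F i) }
  ; decode-encode = λ { nothing → refl ; (just a) → cong just (decode-encode F a) } }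

⊎-finite : ∀ {A B} → Finite A → Finite B → Finite (A ⊎ B)
⊎-finite {A} {B} F G = record
  { size = size F + size G
  ; encode = Fin.join (size F) (size G) ∘ Sum.map (encode F) (encode G)
  ; decode = Sum.map (decode F) (decode G) ∘ Fin.splitAt (size F)
  ; decode-encode = λ s → trans
      (cong (Sum.map (decode F) (decode G)) (splitAt-join (size F) (size G) (Sum.map (encode F) (encode G) s)))
      (retract s) }
  where
  retract : ∀ s → Sum.map (decode F) (decode G) (Sum.map (encode F) (encode G) s) ≡ s
  retract (inj₁ a) = cong inj₁ (decode-encode F a)
  retract (inj₂ b) = cong inj₂ (decode-encode G b)

×-finite : ∀ {A B} → Finite A → Finite B → Finite (A × B)
×-finite F G = record
  { size = size F * size G
  ; encode = λ (a , b) → Fin.combine (encode F a) (encode G b)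
  ; decode = Product.map (decode F) (decode G) ∘ Fin.remQuot (size G)
  ; decode-encode = λ (a , b) → trans
      (cong (Product.map (decode F) (decode G)) (remQuot-combine (encode F a) (encode G b)))
      (cong₂ _,_ (decode-encode F a) (decode-encode G b)) }

Vec-finite : ∀ {A} → Finite A → ∀ n → Finite (Vec A n)
Vec-finite F zero = record
  { size = 1 ; encode = λ _ → zero ; decode = λ _ → [] ; decode-encode = λ { [] → refl } }
Vec-finite F (suc n) = record
  { size = size G
  ; encode = λ { (x ∷ xs) → encode G (x , xs) }
  ; decode = λ i → proj₁ (decode G i) ∷ proj₂ (decode G i)
  ; decode-encode = λ { (x ∷ xs) → cong (λ (y , ys) → y ∷ ys) (decode-encode G (x , xs)) } }
  where G = ×-finite F (Vec-finite F n)

-- The Hales–Jewett theorem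

-- `nothing` is the variable of a combinatorial line. A template without it is a constant word, so
-- lines come with a witness of `Moving`.
Template : Set → ℕ → Set
Template A n = Vec (Maybe A) n

Moving : ∀ {A n} → Template A n → Fin n → Set
Moving w t = lookup w t ≡ nothing

fill : ∀ {A n} → Template A n → A → Vec A n
fill w a = map (fromMaybe a) w

fill-constant : ∀ {A n} (p : Vec A n) a → fill (map just p) a ≡ p
fill-constant p a = trans (sym (map-∘ (fromMaybe a) just p)) (map-id p)

fill-++ : ∀ {A m n} (w : Template A m) (w′ : Template A n) a → fill (w ++ w′) a ≡ fill w a ++ fill w′ a
fill-++ w w′ a = map-++ (fromMaybe a) w w′

fill-map : ∀ {A B n} (f : A → B) (w : Template A n) a → fill (map (Maybe.map f) w) (f a) ≡ map f (fill w a)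
fill-map f w a = trans (sym (map-∘ _ _ w)) (trans (map-cong pointwise w) (map-∘ _ _ w))
  where
  pointwise : ∀ x → fromMaybe (f a) (Maybe.map f x) ≡ f (fromMaybe a x)
  pointwise (just _) = refl
  pointwise nothing  = refl

MonoLine : ∀ {A C : Set} {n} → (Vec A n → C) → Set
MonoLine {A} {n = n} f =
  Σ (Template A n) λ w → ∃ (Moving w) × (∀ a b → f (fill w a) ≡ f (fill w b))

-- All finite colour sets are quantified at once, because the induction on the alphabet calls the
-- hypothesis with a far larger set of colours.
HalesJewett : ℕ → Set₁
HalesJewett m = ∀ {C} → Finite C → ∃ λ n → (f : Vec (Fin m) n → C) → MonoLine f

-- Colour focusing: the letter zero is the one added to the alphabet, so that a
-- focused line is monochromatic away from zero.
record Focused {m n} {C : Set} (f : Vec (Fin (suc m)) n → C) (j : ℕ) : Set where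
  field
    focus           : Vec (Fin (suc m)) n
    line            : Fin j → Template (Fin (suc m)) n
    moving          : ∀ i → ∃ (Moving (line i))
    colour          : Fin j → C
    on-line         : ∀ i a → f (fill (line i) (suc a)) ≡ colour i
    at-focus        : ∀ i → fill (line i) zero ≡ focus
    colour-distinct : ∀ i i′ → colour i ≡ colour i′ → i ≡ i′

module HalesJewettStep {m : ℕ} (hj : HalesJewett (suc m)) {C : Set} (F : Finite C) where

  Letter : Set
  Letter = Fin (suc (suc m))

  -- By `w-mono` the colouring `g` induced on tails stays the same along `w`, whose letters all
  -- become nonzero. Hence lines of `g` can be prolonged by `w`, moving in both blocks at once,
  -- without changing their colours away from `zero`.
  module Extend {n₁ n₂} (f : Vec Letter (n₂ + n₁) → C)
      (w : Template (Fin (suc m)) n₂) (w-moving : ∃ (Moving w))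
      (w-mono : ∀ a b v → f (map suc (fill w a) ++ v) ≡ f (map suc (fill w b) ++ v)) where

    w⁺ : Template Letter n₂
    w⁺ = map (Maybe.map suc) w

    t : Fin n₂
    t = proj₁ w-moving

    w⁺-moving : Moving w⁺ t
    w⁺-moving = trans (lookup-map t (Maybe.map suc) w) (cong (Maybe.map suc) (proj₂ w-moving))

    base : Vec Letter n₂
    base = map suc (fill w zero)

    g : Vec Letter n₁ → C
    g v = f (base ++ v)

    w⁺-base : ∀ a v → f (fill w⁺ (suc a) ++ v) ≡ g v
    w⁺-base a v = trans (cong (λ u → f (u ++ v)) (fill-map suc w a)) (w-mono a zero v)

    pad : MonoLine g → MonoLine f
    pad (ℓ , (s , s-moving) , mono) =
      map just base ++ ℓ ,
      (n₂ ↑ʳ s , trans (lookup-++ʳ (map just base) ℓ s) s-moving) ,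
      λ a b → trans (value a) (trans (mono a b) (sym (value b)))
      where
      value : ∀ a → f (fill (map just base ++ ℓ) a) ≡ g (fill ℓ a)
      value a = cong f (trans (fill-++ (map just base) ℓ a) (cong (_++ fill ℓ a) (fill-constant base a)))

    module _ {j} (φ : Focused g j) where
      open Focused φ

      -- The focus is the missing point, at letter `zero`, of each focused line.
      complete : ∀ i → colour i ≡ g focus → MonoLine g
      complete i eq = line i , moving i , λ a b → trans (value a) (sym (value b))
        where
        value : ∀ a → g (fill (line i) a) ≡ colour i
        value zero    = trans (cong g (at-focus i)) (sym eq)
        value (suc a) = on-line i a

      -- Each old line moves together with `w⁺`. The additional line moves in `w⁺` only, with tail
      -- `focus`, and so gets the new colour `g focus`. At letter `zero` they all meet.
      extend : (∀ i → colour i ≢ g focus) → Focused f (suc j)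
      extend new = record
        { focus = fill w⁺ zero ++ focus
        ; line = line′
        ; moving = λ i → t ↑ˡ n₁ , line′-moving i
        ; colour = colour′
        ; on-line = on-line′
        ; at-focus = at-focus′
        ; colour-distinct = distinct }
        where
        line′ : Fin (suc j) → Template Letter (n₂ + n₁)
        line′ zero    = w⁺ ++ map just focus
        line′ (suc i) = w⁺ ++ line i

        line′-moving : ∀ i → Moving (line′ i) (t ↑ˡ n₁)
        line′-moving zero    = trans (lookup-++ˡ w⁺ (map just focus) t) w⁺-moving
        line′-moving (suc i) = trans (lookup-++ˡ w⁺ (line i) t) w⁺-moving

        colour′ : Fin (suc j) → C
        colour′ zero    = g focus
        colour′ (suc i) = colour i

        on-line′ : ∀ i a → f (fill (line′ i) (suc a)) ≡ colour′ i
        on-line′ zero a =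
          trans (cong f (trans (fill-++ w⁺ (map just focus) (suc a))
                               (cong (fill w⁺ (suc a) ++_) (fill-constant focus (suc a)))))
                (w⁺-base a focus)
        on-line′ (suc i) a =
          trans (cong f (fill-++ w⁺ (line i) (suc a)))
                (trans (w⁺-base a (fill (line i) (suc a))) (on-line i a))

        at-focus′ : ∀ i → fill (line′ i) zero ≡ fill w⁺ zero ++ focus
        at-focus′ zero    = trans (fill-++ w⁺ (map just focus) zero)
                                  (cong (fill w⁺ zero ++_) (fill-constant focus zero))
        at-focus′ (suc i) = trans (fill-++ w⁺ (line i) zero)
                                  (cong (fill w⁺ zero ++_) (at-focus i))

        distinct : ∀ i i′ → colour′ i ≡ colour′ i′ → i ≡ i′
        distinct zero    zero     _  = refl
        distinct zero    (suc i′) eq = contradiction (sym eq) (new i′)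
        distinct (suc i) zero     eq = contradiction eq (new i)
        distinct (suc i) (suc i′) eq = cong suc (colour-distinct i i′ eq)

      grow : MonoLine f ⊎ Focused f (suc j)
      grow with any? (λ i → _≟ᶠ_ F (colour i) (g focus))
      ... | yes (i , eq) = inj₁ (pad (complete i eq))
      ... | no new       = inj₂ (extend λ i eq → new (i , eq))

  focusing : ∀ j → ∃ λ n → (f : Vec Letter n → C) → MonoLine f ⊎ Focused f j
  focusing zero = 0 , λ f → inj₂ record
    { focus = [] ; line = λ () ; moving = λ () ; colour = λ ()
    ; on-line = λ () ; at-focus = λ () ; colour-distinct = λ () }
  focusing (suc j) with focusing j
  ... | n₁ , focusing₁ = n₂ + n₁ , result
    where
    Words : Finite (Vec Letter n₁)
    Words = Vec-finite (Fin-finite _) n₁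

    -- Words of length n₂ are coloured by the colouring they induce on words of length n₁.
    hj′ = hj (Vec-finite F (size Words))
    n₂ = proj₁ hj′

    result : (f : Vec Letter (n₂ + n₁) → C) → MonoLine f ⊎ Focused f (suc j)
    result f with proj₂ hj′ (λ u → tabulate (λ i → f (map suc u ++ decode Words i)))
    ... | w , w-moving , w-mono = continue (focusing₁ g)
      where
      -- Equality of the two induced colourings is read off at the entry that belongs to `v`.
      same : ∀ a b v → f (map suc (fill w a) ++ v) ≡ f (map suc (fill w b) ++ v)
      same a b v = subst (λ v → f (map suc (fill w a) ++ v) ≡ f (map suc (fill w b) ++ v))
        (decode-encode Words v)
        (trans (sym (lookup∘tabulate _ (encode Words v)))
          (trans (cong (λ c → lookup c (encode Words v)) (w-mono a b))
            (lookup∘tabulate _ (encode Words v))))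

      open Extend f w w-moving same

      continue : MonoLine g ⊎ Focused g j → MonoLine f ⊎ Focused f (suc j)
      continue (inj₁ ℓ) = inj₁ (pad ℓ)
      continue (inj₂ φ) = grow φ

  step : ∃ λ n → (f : Vec Letter n → C) → MonoLine f
  -- Focused lines have distinct colours, so there cannot be more of them than colours.
  step with focusing (suc (size F))
  ... | n , focusing′ = n , λ f → [ id , ⊥-elim ∘ absurd ] (focusing′ f)
    where
    absurd : ∀ {f} → ¬ Focused f (suc (size F))
    absurd φ with pigeonhole (n<1+n (size F)) (encode F ∘ Focused.colour φ)
    ... | i , i′ , i<i′ , eq =
      Fin.<⇒≢ i<i′ (Focused.colour-distinct φ i i′ (encode-injective F eq))

-- The step starts from a nonempty alphabet, since its base word fills `w` with the letter `zero`.
-- This makes alphabets of size 0 and 1 the base cases.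
halesJewett : ∀ m → HalesJewett m
halesJewett zero          F = 1 , λ f → nothing ∷ [] , (zero , refl) , λ ()
halesJewett (suc zero)    F = 1 , λ f → nothing ∷ [] , (zero , refl) , λ { zero zero → refl }
halesJewett (suc (suc m)) F = HalesJewettStep.step (halesJewett (suc m)) F

-- Ramsey's theorem

_≟ᶜ_ : DecidableEquality Colour
_≟ᶜ_ = _≟ᶠ_ Colour-finite

module _ {A : Set} where

  of-colour : (A → Colour) → Colour → List A → List A
  of-colour h c = filter (λ y → h y ≟ᶜ c)

  length-of-colour : ∀ h xs → length xs ≡ length (of-colour h red xs) + length (of-colour h blue xs)
  length-of-colour h [] = refl
  length-of-colour h (x ∷ xs) with h x
  ... | red  = cong suc (length-of-colour h xs)
  ... | blue = trans (cong suc (length-of-colour h xs)) (sym (ℕ.+-suc _ _))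

  -- Only ascending pairs are constrained, as `η` may be asymmetric: it will be a colour chosen
  -- separately for each ordered pair of parts.
  Homogeneous : (A → A → Colour) → Colour → List A → ℕ → Set
  Homogeneous η c xs p = Σ (Vec A p) λ ys →
    (∀ i → lookup ys i ∈ xs) ×
    (∀ i j → i Fin.< j → lookup ys i ≢ lookup ys j × η (lookup ys i) (lookup ys j) ≡ c)

  Homogeneous-cons : ∀ η {c x xs p} → All (x ≢_) xs →
    Homogeneous η c (of-colour (η x) c xs) p → Homogeneous η c (x ∷ xs) (suc p)
  Homogeneous-cons η {c} {x} {xs} {p} x∉xs (ys , ys⊆ , ys-hom) = x ∷ ys , ⊆ , hom
    where
    source : ∀ i → lookup ys i ∈ xs × η x (lookup ys i) ≡ c
    source i = ∈-filter⁻ (λ y → η x y ≟ᶜ c) (ys⊆ i)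

    ⊆ : ∀ i → lookup (x ∷ ys) i ∈ x ∷ xs
    ⊆ zero    = here refl
    ⊆ (suc i) = there (proj₁ (source i))

    hom : ∀ i j → i Fin.< j → lookup (x ∷ ys) i ≢ lookup (x ∷ ys) j × η (lookup (x ∷ ys) i) (lookup (x ∷ ys) j) ≡ c
    hom zero    (suc j) _         = All.lookup x∉xs (proj₁ (source j)) , proj₂ (source j)
    hom (suc i) (suc j) (s≤s i<j) = ys-hom i j i<j

  Homogeneous-weaken : ∀ η {c x xs h d p} →
    Homogeneous η c (of-colour h d xs) p → Homogeneous η c (x ∷ xs) p
  Homogeneous-weaken η {h = h} {d} (ys , ys⊆ , ys-hom) =
    ys , (λ i → there (proj₁ (∈-filter⁻ (λ y → h y ≟ᶜ d) (ys⊆ i)))) , ys-hom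

+-≤-split : ∀ m n {a b} → m + n ≤ a + b → m ≤ a ⊎ n ≤ b
+-≤-split m n {a} le with m ℕ.≤? a
... | yes m≤a = inj₁ m≤a
... | no  m≰a = inj₂ (ℕ.+-cancelˡ-≤ a _ _ (ℕ.≤-trans (ℕ.+-monoˡ-≤ n (ℕ.<⇒≤ (ℕ.≰⇒> m≰a))) le))

-- The recursion R(p, q) ≤ R(p-1, q) + R(p, q-1) + 1: one of the two colour neighbourhoods of the
-- head is long enough. Lists without repetition are used because these neighbourhoods are again
-- such lists.
ramsey : ∀ p q → ∃ λ N → ∀ {A : Set} (η : A → A → Colour) xs → Unique xs → N ≤ length xs →
  Homogeneous η red xs p ⊎ Homogeneous η blue xs q
ramsey zero    q       = 0 , λ η xs _ _ → inj₁ ([] , (λ ()) , λ ())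
ramsey (suc p) zero    = 0 , λ η xs _ _ → inj₂ ([] , (λ ()) , λ ())
ramsey (suc p) (suc q) with ramsey p (suc q) | ramsey (suc p) q
... | N₁ , ramsey₁ | N₂ , ramsey₂ = suc (N₁ + N₂) , result
  where
  result : ∀ {A : Set} (η : A → A → Colour) xs → Unique xs → suc (N₁ + N₂) ≤ length xs →
    Homogeneous η red xs (suc p) ⊎ Homogeneous η blue xs (suc q)
  result η (x ∷ xs) (x∉xs ∷ xs!) (s≤s le)
    with +-≤-split N₁ N₂ (subst (N₁ + N₂ ≤_) (length-of-colour (η x) xs) le)
  ... | inj₁ le₁ = Sum.map (Homogeneous-cons η x∉xs) (Homogeneous-weaken η)
        (ramsey₁ η _ (AllPairs-filter⁺ (λ y → η x y ≟ᶜ red) xs!) le₁)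
  ... | inj₂ le₂ = Sum.map (Homogeneous-weaken η) (Homogeneous-cons η x∉xs)
        (ramsey₂ η _ (AllPairs-filter⁺ (λ y → η x y ≟ᶜ blue) xs!) le₂)

ramsey-diagonal : ∀ b → ∃ λ N → (η : Fin N → Fin N → Colour) →
  Σ (Vec (Fin N) b) λ ys → ∃ λ c →
    ∀ i j → i Fin.< j → lookup ys i ≢ lookup ys j × η (lookup ys i) (lookup ys j) ≡ c
ramsey-diagonal b with ramsey b b
... | N , ramsey′ = N , λ η → [ (λ (ys , _ , hom) → ys , red , hom) , (λ (ys , _ , hom) → ys , blue , hom) ]
    (ramsey′ η (allFin N) (allFin⁺ N) (≤-reflexive (sym (length-tabulate id))))

-- Edge-coloured graphs without monochromatic cliques

module _ (κ : ℕ) where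

  -- The three successors provide the three clique vertices on which `clique-free′` relies.
  k : ℕ
  k = suc (suc (suc κ))

  record Structure (V : Set) : Set₁ where
    field
      R           : Colour → V → V → Set
      R?          : ∀ d u v → Dec (R d u v)
      R-sym       : ∀ {d u v} → R d u v → R d v u
      R-irr       : ∀ {d v} → ¬ R d v v
      R-unique    : ∀ {d d′ u v} → R d u v → R d′ u v → d ≡ d′
      clique-free : ∀ d (f : Fin k → V) → ¬ (∀ i j → i ≢ j → R d (f i) (f j))
  open Structure

  -- Copies are homomorphic images; by `R-irr` adjacent vertices stay distinct, so cliques are
  -- mapped injectively.
  Hom : ∀ {V W} → Structure V → Structure W → (V → W) → Set
  Hom A B g = ∀ {d u v} → R A d u v → R B d (g u) (g v)

  pullback : ∀ {V W} → (V → W) → Structure W → Structure V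
  pullback h A = record
    { R = λ d u v → R A d (h u) (h v)
    ; R? = λ d u v → R? A d (h u) (h v)
    ; R-sym = R-sym A
    ; R-irr = R-irr A
    ; R-unique = R-unique A
    ; clique-free = λ d f → clique-free A d (h ∘ f) }

  separate : ∀ {V N} → (V → Fin N) → Structure V → Structure V
  separate p A = record
    { R = λ d u v → p u ≢ p v × R A d u v
    ; R? = λ d u v → ¬? (p u Fin.≟ p v) ×-dec R? A d u v
    ; R-sym = λ (ne , e) → ne ∘ sym , R-sym A e
    ; R-irr = λ (_ , e) → R-irr A e
    ; R-unique = λ (_ , e) (_ , e′) → R-unique A e e′
    ; clique-free = λ d f cl → clique-free A d f λ i j i≢j → proj₂ (cl i j i≢j) }

  disjointUnion : ∀ {I V} → Finite I → (I → Structure V) → Structure (I × V)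
  disjointUnion F A = record
    { R = λ d (i , u) (j , v) → i ≡ j × R (A i) d u v
    ; R? = λ d (i , u) (j , v) → _≟ᶠ_ F i j ×-dec R? (A i) d u v
    ; R-sym = λ { (refl , e) → refl , R-sym (A _) e }
    ; R-irr = λ (_ , e) → R-irr (A _) e
    ; R-unique = λ (_ , e) (_ , e′) → R-unique (A _) e e′
    ; clique-free = free }
    where
    free : ∀ d f → ¬ (∀ i j → i ≢ j → proj₁ (f i) ≡ proj₁ (f j) × R (A (proj₁ (f i))) d (proj₂ (f i)) (proj₂ (f j)))
    -- Every vertex of the clique is adjacent to `f zero`, hence lies in its component.
    free d f cl = clique-free (A (proj₁ (f zero))) d (proj₂ ∘ f)
      λ i j i≢j → subst (λ c → R (A c) d (proj₂ (f i)) (proj₂ (f j))) (component i) (proj₂ (cl i j i≢j))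
      where
      component : ∀ i → proj₁ (f i) ≡ proj₁ (f zero)
      component zero    = refl
      component (suc i) = proj₁ (cl (suc i) zero λ ())

  -- Partite graphs and their arrow relation

  record Partite (N : ℕ) : Set₁ where
    field
      V             : Set
      finite        : Finite V
      structure     : Structure V
      part          : V → Fin N
      part-distinct : ∀ {d u v} → R structure d u v → part u ≢ part v
  open Partite

  record PartiteHom {N} (P Q : Partite N) : Set where
    field
      to       : V P → V Q
      to-hom   : Hom (structure P) (structure Q) to
      to-part  : ∀ v → part Q (to v) ≡ part P v
  open PartiteHom

  id-hom : ∀ {N} (P : Partite N) → PartiteHom P P
  id-hom P = record { to = id ; to-hom = id ; to-part = λ _ → refl }

  _∘-hom_ : ∀ {N} {P Q S : Partite N} → PartiteHom Q S → PartiteHom P Q → PartiteHom P S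
  h ∘-hom g = record
    { to = to h ∘ to g
    ; to-hom = to-hom h ∘ to-hom g
    ; to-part = λ v → trans (to-part h (to g v)) (to-part g v) }

  module _ {N} (c : Colour) (P : Partite N) where

    ConstantBetween : Fin N × Fin N → (V P → V P → Colour) → Set
    ConstantBetween (i , j) χ = ∃ λ η →
      ∀ {u v} → part P u ≡ i → part P v ≡ j → R (structure P) c u v → χ u v ≡ η

    _⟶_ : Partite N → List (Fin N × Fin N) → Set
    Q ⟶ L = (χ : V Q → V Q → Colour) → (∀ u v → χ u v ≡ χ v u) →
      Σ (PartiteHom P Q) λ g → ∀ {ij} → ij ∈ L → ConstantBetween ij (λ u v → χ (to g u) (to g v))

  -- The partite step for one pair of parts

  module PartiteStep {N} (c : Colour) (P : Partite N) (i j : Fin N) (i≢j : i ≢ j) where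

    private
      S = structure P

    IsEdge : V P × V P → Set
    IsEdge (u , v) = part P u ≡ i × part P v ≡ j × R S c u v

    isEdge? : Decidable IsEdge
    isEdge? (u , v) = (part P u Fin.≟ i) ×-dec (part P v Fin.≟ j) ×-dec R? S c u v

    pairs : Finite (V P × V P)
    pairs = ×-finite (finite P) (finite P)

    -- These edges form the Hales-Jewett alphabet: a word of `n` of them is an edge of the power.
    edges : List (V P × V P)
    edges = filter isEdge? (elements pairs)

    m : ℕ
    m = length edges

    edge : Fin m → V P × V P
    edge = List.lookup edges

    edge-isEdge : ∀ a → IsEdge (edge a)
    edge-isEdge a = proj₂ (∈-filter⁻ isEdge? {xs = elements pairs} (∈-lookup {xs = edges} a))

    edge-surjective : ∀ {e} → IsEdge e → ∃ λ a → e ≡ edge a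
    edge-surjective {e} p = index e∈ , lookup-index e∈
      where
      e∈ : e ∈ edges
      e∈ = ∈-filter⁺ isEdge? (∈-elements pairs e) p

    n : ℕ
    n = proj₁ (halesJewett m Colour-finite)

    side : Bool → Fin N
    side b = if b then i else j

    end : Bool → V P × V P → V P
    end true  = proj₁
    end false = proj₂

    Copy : Set
    Copy = Fin n × Template (Fin m) n

    copies : Finite Copy
    copies = ×-finite (Fin-finite n) (Vec-finite (Maybe-finite (Fin-finite m)) n)

    vectors : Finite (Vec (V P) n)
    vectors = Vec-finite (finite P) n

    -- inner true and inner false are the new parts i and j; each combinatorial
    -- line w, together with a coordinate t meant to be moving in w, carries a
    -- copy of the remaining parts.
    V′ : Set
    V′ = (Bool × Vec (V P) n) ⊎ (Copy × V P)

    pattern inner b x = inj₁ (b , x)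
    pattern outer t w v = inj₂ ((t , w) , v)

    -- The point that represents `v` on side `b` of the line `w`: fixed letters contribute their own
    -- end on that side.
    place : Template (Fin m) n → Bool → V P → Vec (V P) n
    place w b v = map (maybe (end b ∘ edge) v) w

    lookup-place : ∀ w b v t → lookup (place w b v) t ≡ maybe (end b ∘ edge) v (lookup w t)
    lookup-place w b v t = lookup-map t _ w

    -- For d = c this is the power of the bipartite graph of c-edges. An edge of the
    -- other colour is allowed c-edges in some coordinates, because these are what
    -- a line has in its fixed coordinates.
    InnerR : Colour → Vec (V P) n → Vec (V P) n → Set
    InnerR d x y =
      (∀ t → R S c (lookup x t) (lookup y t) ⊎ R S d (lookup x t) (lookup y t)) ×
      (∃ λ t → R S d (lookup x t) (lookup y t))

    innerR? : ∀ d x y → Dec (InnerR d x y)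
    innerR? d x y =
      all? (λ t → R? S c (lookup x t) (lookup y t) ⊎-dec R? S d (lookup x t) (lookup y t)) ×-dec
      any? (λ t → R? S d (lookup x t) (lookup y t))

    -- A coordinate with a `d`-edge also carries a `c`- or a `d′`-edge, so `d` is `c` or `d′`.
    -- Symmetrically `d′` is `c` or `d`.
    innerR-unique : ∀ {d d′} x y → InnerR d x y → InnerR d′ x y → d ≡ d′
    innerR-unique x y (every , t , e) (every′ , t′ , e′) with every′ t | every t′
    ... | inj₂ f | _      = R-unique S e f
    ... | inj₁ _ | inj₂ f = R-unique S f e′
    ... | inj₁ f | inj₁ f′ = trans (R-unique S e f) (R-unique S f′ e′)

    -- Coordinate `t` recovers the vertex that `x` represents on `w`. As entries of `x` may come
    -- from any part of `P`, the first condition is what keeps the edge between distinct parts.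
    CrossR : Colour → Copy → V P → Bool → Vec (V P) n → Set
    CrossR d (t , w) v b x = part P v ≢ side b × x ≡ place w b (lookup x t) × R S d v (lookup x t)

    crossR? : ∀ d φ v b x → Dec (CrossR d φ v b x)
    crossR? d (t , w) v b x =
      ¬? (part P v Fin.≟ side b) ×-dec _≟ᶠ_ vectors x (place w b (lookup x t)) ×-dec R? S d v (lookup x t)

    R′ : Colour → V′ → V′ → Set
    R′ d (inner true x)  (inner true y)  = ⊥
    R′ d (inner true x)  (inner false y) = InnerR d x y
    R′ d (inner false x) (inner true y)  = InnerR d y x
    R′ d (inner false x) (inner false y) = ⊥
    R′ d (inner b x)     (inj₂ (φ , v))  = CrossR d φ v b x
    R′ d (inj₂ (φ , v))  (inner b x)     = CrossR d φ v b x
    R′ d (inj₂ (φ , u))  (inj₂ (φ′ , v)) = φ ≡ φ′ × R S d u v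

    R′? : ∀ d u v → Dec (R′ d u v)
    R′? d (inner true x)  (inner true y)  = no id
    R′? d (inner true x)  (inner false y) = innerR? d x y
    R′? d (inner false x) (inner true y)  = innerR? d y x
    R′? d (inner false x) (inner false y) = no id
    R′? d (inner true x)  (inj₂ (φ , v))  = crossR? d φ v true x
    R′? d (inner false x) (inj₂ (φ , v))  = crossR? d φ v false x
    R′? d (inj₂ (φ , v))  (inner b x)     = crossR? d φ v b x
    R′? d (inj₂ (φ , u))  (inj₂ (φ′ , v)) = _≟ᶠ_ copies φ φ′ ×-dec R? S d u v

    R′-sym : ∀ {d} u v → R′ d u v → R′ d v u
    R′-sym (inner true x)  (inner false y) e = e
    R′-sym (inner false x) (inner true y)  e = e
    R′-sym (inner true x)  (inj₂ _)        e = e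
    R′-sym (inner false x) (inj₂ _)        e = e
    R′-sym (inj₂ _)        (inner true x)  e = e
    R′-sym (inj₂ _)        (inner false x) e = e
    R′-sym (inj₂ _)        (inj₂ _)        (eq , e) = sym eq , R-sym S e

    R′-unique : ∀ {d d′} u v → R′ d u v → R′ d′ u v → d ≡ d′
    R′-unique (inner true x)  (inner false y) e e′ = innerR-unique x y e e′
    R′-unique (inner false x) (inner true y)  e e′ = innerR-unique y x e e′
    R′-unique (inner true x)  (inj₂ _)        (_ , _ , e) (_ , _ , e′) = R-unique S e e′
    R′-unique (inner false x) (inj₂ _)        (_ , _ , e) (_ , _ , e′) = R-unique S e e′
    R′-unique (inj₂ _)        (inner b x)     (_ , _ , e) (_ , _ , e′) = R-unique S e e′
    R′-unique (inj₂ _)        (inj₂ _)        (_ , e) (_ , e′) = R-unique S e e′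

    part′ : V′ → Fin N
    part′ (inner b x)    = side b
    part′ (inj₂ (φ , v)) = part P v

    part′-distinct : ∀ {d} u v → R′ d u v → part′ u ≢ part′ v
    part′-distinct (inner true x)  (inner false y) _ = i≢j
    part′-distinct (inner false x) (inner true y)  _ = i≢j ∘ sym
    part′-distinct (inner true x)  (inj₂ _)        (ne , _) = ne ∘ sym
    part′-distinct (inner false x) (inj₂ _)        (ne , _) = ne ∘ sym
    part′-distinct (inj₂ _)        (inner b x)     (ne , _) = ne
    part′-distinct (inj₂ _)        (inj₂ _)        (_ , e) = part-distinct P e

    -- A clique has at most two inner vertices, hence an outer one, which
    -- places the whole clique in a single copy; reading off the coordinate t
    -- then maps the clique back to P.
    module _ (t : Fin n) (w : Template (Fin m) n) where

      InCopy : V′ → Set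
      InCopy (inner b x)    = x ≡ place w b (lookup x t)
      InCopy (inj₂ (φ , _)) = φ ≡ (t , w)

      project : V′ → V P
      project (inner b x)    = lookup x t
      project (inj₂ (_ , v)) = v

      -- Take the coordinate `s` with a `d`-edge. If `s` is moving, its entries are those at `t`. If
      -- it is fixed, it carries a `c`-edge, so `d` is `c`, and both alternatives at `t` give a
      -- `d`-edge.
      project-inner : ∀ {d} x y → x ≡ place w true (lookup x t) → y ≡ place w false (lookup y t) →
        InnerR d x y → R S d (lookup x t) (lookup y t)
      project-inner {d} x y x∈ y∈ (every , s , e)
        with lookup w s | trans (cong (λ z → lookup z s) x∈) (lookup-place w true (lookup x t) s)
                        | trans (cong (λ z → lookup z s) y∈) (lookup-place w false (lookup y t) s)
      ... | nothing | eqx | eqy = subst₂ (R S d) eqx eqy e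
      ... | just a  | eqx | eqy = [ subst (λ c → R S c (lookup x t) (lookup y t)) (sym d≡c) , id ] (every t)
        where
        d≡c : d ≡ c
        d≡c = R-unique S (subst₂ (R S d) eqx eqy e) (proj₂ (proj₂ (edge-isEdge a)))

      project-hom : ∀ {d} u v → InCopy u → InCopy v → R′ d u v → R S d (project u) (project v)
      project-hom (inner true x)  (inner false y) u∈ v∈ e = project-inner x y u∈ v∈ e
      project-hom (inner false x) (inner true y)  u∈ v∈ e = R-sym S (project-inner y x v∈ u∈ e)
      project-hom (inner true x)  (inj₂ _) u∈   refl      (_ , _ , e) = R-sym S e
      project-hom (inner false x) (inj₂ _) u∈   refl      (_ , _ , e) = R-sym S e
      project-hom (inj₂ _)        (inner b x) refl v∈     (_ , _ , e) = e
      project-hom (inj₂ _)        (inj₂ _) _ _ (_ , e) = e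

      adjacent-inCopy : ∀ {d v} u → R′ d u (outer t w v) → InCopy u
      adjacent-inCopy (inner true x)  (_ , x∈ , _) = x∈
      adjacent-inCopy (inner false x) (_ , x∈ , _) = x∈
      adjacent-inCopy (inj₂ _)        (eq , _)     = eq

    IsOuter : V′ → Set
    IsOuter u = ∃ λ t → ∃ λ w → ∃ λ v → u ≡ outer t w v

    -- The inner vertices induce a bipartite graph, which has no triangle.
    outer-of-triangle : ∀ {d} u₀ u₁ u₂ → R′ d u₀ u₁ → R′ d u₀ u₂ → R′ d u₁ u₂ → IsOuter u₀ ⊎ IsOuter u₁ ⊎ IsOuter u₂
    outer-of-triangle (inj₂ _)        _               _               _ _ _ = inj₁ (_ , _ , _ , refl)
    outer-of-triangle _               (inj₂ _)        _               _ _ _ = inj₂ (inj₁ (_ , _ , _ , refl))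
    outer-of-triangle _               _               (inj₂ _)        _ _ _ = inj₂ (inj₂ (_ , _ , _ , refl))
    outer-of-triangle (inner true _)  (inner false _) (inner true _)  _ () _
    outer-of-triangle (inner true _)  (inner false _) (inner false _) _ _ ()
    outer-of-triangle (inner false _) (inner true _)  (inner true _)  _ _ ()
    outer-of-triangle (inner false _) (inner true _)  (inner false _) _ () _

    clique-free′ : ∀ d (f : Fin k → V′) → ¬ (∀ a b → a ≢ b → R′ d (f a) (f b))
    clique-free′ d f cl =
      [ through zero , [ through (suc zero) , through (suc (suc zero)) ] ]
        (outer-of-triangle (f zero) (f (suc zero)) (f (suc (suc zero)))
          (cl _ _ λ ()) (cl _ _ λ ()) (cl _ _ λ ()))
      where
      through : ∀ o → ¬ IsOuter (f o)
      through o (t , w , v , eq) = clique-free S d (project t w ∘ f)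
        λ a b a≢b → project-hom t w (f a) (f b) (inCopy a) (inCopy b) (cl a b a≢b)
        where
        inCopy : ∀ a → InCopy t w (f a)
        inCopy a with a Fin.≟ o
        ... | yes refl = subst (InCopy t w) (sym eq) refl
        ... | no a≢o   = adjacent-inCopy t w (f a) (subst (R′ d (f a)) eq (cl a o a≢o))

    Q : Partite N
    Q = record
      { V = V′
      ; finite = ⊎-finite (×-finite Bool-finite vectors) (×-finite copies (finite P))
      ; structure = record
          { R = R′ ; R? = R′?
          ; R-sym = λ {_} {u} {v} → R′-sym u v
          ; R-irr = λ {_} {v} e → part′-distinct v v e refl
          ; R-unique = λ {_} {_} {u} {v} → R′-unique u v
          ; clique-free = clique-free′ }
      ; part = part′
      ; part-distinct = λ {_} {u} {v} → part′-distinct u v }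

    data Position (v : V P) : Set where
      on   : ∀ b → part P v ≡ side b → Position v
      away : (∀ b → part P v ≢ side b) → Position v

    position : ∀ v → Position v
    position v with part P v Fin.≟ i | part P v Fin.≟ j
    ... | yes eq | _      = on true eq
    ... | no _   | yes eq = on false eq
    ... | no ne  | no ne′ = away λ { true → ne ; false → ne′ }

    module Embedding (w : Template (Fin m) n) (t : Fin n) (t-moving : Moving w t) where

      embedAt : ∀ v → Position v → V′
      embedAt v (on b _) = inner b (place w b v)
      embedAt v (away _) = outer t w v

      lookup-moving : ∀ b v → lookup (place w b v) t ≡ v
      lookup-moving b v = trans (lookup-place w b v t) (cong (maybe (end b ∘ edge) v) t-moving)

      inner-hom : ∀ {d u v} → R S d u v → InnerR d (place w true u) (place w false v)
      inner-hom {d} {u} {v} e = every ,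
        t , subst₂ (R S d) (sym (lookup-moving true u)) (sym (lookup-moving false v)) e
        where
        every : ∀ s → R S c (lookup (place w true u) s) (lookup (place w false v) s) ⊎
                      R S d (lookup (place w true u) s) (lookup (place w false v) s)
        every s rewrite lookup-place w true u s | lookup-place w false v s with lookup w s
        -- A moving coordinate repeats the given edge; a fixed one holds a letter, which is a
        -- `c`-edge.
        ... | nothing = inj₂ e
        ... | just a  = inj₁ (proj₂ (proj₂ (edge-isEdge a)))

      cross-hom : ∀ {d u v} b → part P v ≢ side b → R S d v u → CrossR d (t , w) v b (place w b u)
      cross-hom {d} {u} {v} b ne e =
        ne , cong (place w b) (sym (lookup-moving b u)) , subst (R S d v) (sym (lookup-moving b u)) e

      embedAt-hom : ∀ {d u v} p q → R S d u v → R′ d (embedAt u p) (embedAt v q)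
      embedAt-hom (on true eq)  (on true eq′)  e = part-distinct P e (trans eq (sym eq′))
      embedAt-hom (on true eq)  (on false eq′) e = inner-hom e
      embedAt-hom (on false eq) (on true eq′)  e = inner-hom (R-sym S e)
      embedAt-hom (on false eq) (on false eq′) e = part-distinct P e (trans eq (sym eq′))
      embedAt-hom (on true eq)  (away ne)      e = cross-hom true (ne true) (R-sym S e)
      embedAt-hom (on false eq) (away ne)      e = cross-hom false (ne false) (R-sym S e)
      embedAt-hom (away ne)     (on b eq)      e = cross-hom b (ne b) e
      embedAt-hom (away ne)     (away ne′)     e = refl , e

      embedAt-part : ∀ v p → part′ (embedAt v p) ≡ part P v
      embedAt-part v (on b eq) = sym eq
      embedAt-part v (away _)  = refl

      embedAt-side : ∀ v b p → part P v ≡ side b → embedAt v p ≡ inner b (place w b v)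
      embedAt-side v true  (on true _)   eq = refl
      embedAt-side v false (on false _)  eq = refl
      embedAt-side v true  (on false eq′) eq = contradiction (trans (sym eq) eq′) i≢j
      embedAt-side v false (on true eq′) eq = contradiction (trans (sym eq′) eq) i≢j
      embedAt-side v b     (away ne)     eq = contradiction eq (ne b)

      embedding : PartiteHom P Q
      embedding = record
        { to = λ v → embedAt v (position v)
        ; to-hom = λ {_} {u} {v} → embedAt-hom (position u) (position v)
        ; to-part = λ v → embedAt-part v (position v) }

    -- Thus the word `fill w a`, seen as an edge of the power, is the image of edge `a` in the copy
    -- of `P` along `w`.
    place-end : ∀ w b a → map (end b ∘ edge) (fill w a) ≡ place w b (end b (edge a))
    place-end w b a = trans (sym (map-∘ _ _ w)) (map-cong pointwise w)
      where
      pointwise : ∀ x → end b (edge (fromMaybe a x)) ≡ maybe (end b ∘ edge) (end b (edge a)) x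
      pointwise (just _) = refl
      pointwise nothing  = refl

    constant-colour : ∀ {m} (h : Fin m → Colour) → (∀ a b → h a ≡ h b) → ∃ λ η → ∀ a → h a ≡ η
    -- `red` is a default for the case that no `c`-edge joins the two parts.
    constant-colour {zero}  h _     = red , λ ()
    constant-colour {suc m} h const = h zero , λ a → const a zero

    arrow : _⟶_ c P Q ((i , j) ∷ [])
    arrow χ _ with proj₂ (halesJewett m Colour-finite)
                     -- A word of edges gets the colour that `χ` gives to the corresponding edge of
                     -- the power.
                     (λ u → χ (inner true (map (end true ∘ edge) u)) (inner false (map (end false ∘ edge) u)))
    ... | w , (t , t-moving) , mono with constant-colour _ mono
    ...   | η , const = embedding , λ { (here refl) → η , constant }
      where
      open Embedding w t t-moving

      constant : ∀ {u v} → part P u ≡ i → part P v ≡ j → R S c u v → χ (to embedding u) (to embedding v) ≡ η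
      constant {u} {v} u∈i v∈j e with edge-surjective (u∈i , v∈j , e)
      ... | a , eq = trans (cong₂ χ (at true u∈i (cong proj₁ eq)) (at false v∈j (cong proj₂ eq))) (const a)
        where
        at : ∀ b {z} → part P z ≡ side b → z ≡ end b (edge a) →
             to embedding z ≡ inner b (map (end b ∘ edge) (fill w a))
        at b {z} z∈ z≡ = trans (embedAt-side z b (position z) z∈)
          (cong (inner b) (trans (cong (place w b) z≡) (sym (place-end w b a))))

  -- The tail of the list is treated over the graph built for its head. Inside a copy of that graph
  -- with constant tail pairs, the head's arrow finds a copy of `P`. Constancy survives there, since
  -- homomorphisms preserve parts and edge colours.
  partiteConstruction : ∀ {N} c (P : Partite N) L → Σ (Partite N) λ Q → _⟶_ c P Q L
  partiteConstruction c P [] = P , λ χ _ → id-hom P , λ ()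
  partiteConstruction c P ((i , j) ∷ L) with i Fin.≟ j
  ... | yes refl with partiteConstruction c P L
  ...   | Q , Q-arrow = Q , result
    where
    result : _⟶_ c P Q ((i , i) ∷ L)
    result χ χ-sym with Q-arrow χ χ-sym
    ... | g , const = g , λ where
      -- No edge has both ends in one part, so the colour is arbitrary.
      (here refl) → red , λ u∈ v∈ e → contradiction (trans u∈ (sym v∈)) (part-distinct P e)
      (there ij∈) → const ij∈
  partiteConstruction c P ((i , j) ∷ L) | no i≢j
    with partiteConstruction c (PartiteStep.Q c P i j i≢j) L
  ...   | Q , Q-arrow = Q , result
    where
    result : _⟶_ c P Q ((i , j) ∷ L)
    result χ χ-sym with Q-arrow χ χ-sym
    ... | h , h-const
      with PartiteStep.arrow c P i j i≢j (λ u v → χ (to h u) (to h v)) (λ u v → χ-sym (to h u) (to h v))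
    ...   | g , g-const = h ∘-hom g , λ where
      (here refl) → g-const (here refl)
      (there ij∈) → proj₁ (h-const ij∈) , λ u∈ v∈ e → proj₂ (h-const ij∈)
        (trans (to-part g _) u∈) (trans (to-part g _) v∈) (to-hom g e)

  -- The Ramsey property for edges of one colour

  module _ {V : Set} (F : Finite V) (A : Structure V) (c : Colour) where

    private
      N = proj₁ (ramsey-diagonal (size F))

    partAlong : Vec (Fin N) (size F) → V → Fin N
    partAlong ys v = lookup ys (encode F v)

    -- A sequence with repeated parts loses the edges inside a part by `separate`. Sequences with
    -- distinct entries, as Ramsey's theorem selects, keep a full copy of `A`.
    allCopies : Partite N
    allCopies = record
      { V = Vec (Fin N) (size F) × V
      ; finite = ×-finite sequences F
      ; structure = disjointUnion sequences λ ys → separate (partAlong ys) A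
      ; part = λ (ys , v) → partAlong ys v
      ; part-distinct = λ { (refl , ne , _) → ne } }
      where sequences = Vec-finite (Fin-finite N) (size F)

    ConstantCopy : ∀ {W} → Structure W → (W → W → Colour) → Set
    ConstantCopy {W} B χ = Σ (V → W) λ g →
      Hom A B g × ∃ λ η → ∀ {u v} → R A c u v → χ (g u) (g v) ≡ η

    -- The colour of a c-edge in the copies of A depends only on its two parts,
    -- so Ramsey's theorem selects a copy on which it is constant.
    edgeRamsey : Σ Set λ W → Finite W × Σ (Structure W) λ B →
      (χ : W → W → Colour) → (∀ u v → χ u v ≡ χ v u) → ConstantCopy B χ
    edgeRamsey with partiteConstruction c allCopies (cartesianProduct (allFin N) (allFin N))
    ... | Q , Q-arrow = Partite.V Q , finite Q , structure Q , result
      where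
      result : (χ : Partite.V Q → Partite.V Q → Colour) → (∀ u v → χ u v ≡ χ v u) →
        ConstantCopy (structure Q) χ
      result χ χ-sym with Q-arrow χ χ-sym
      ... | h , h-const = select (proj₂ (ramsey-diagonal (size F)) (λ i j → proj₁ (between i j)))
        where
        between : ∀ i j → ConstantBetween c allCopies (i , j) (λ u v → χ (to h u) (to h v))
        between i j = h-const (∈-cartesianProduct⁺ (∈-allFin i) (∈-allFin j))

        select : (Σ (Vec (Fin N) (size F)) λ ys → ∃ λ η → ∀ i j → i Fin.< j →
                   lookup ys i ≢ lookup ys j × proj₁ (between (lookup ys i) (lookup ys j)) ≡ η) →
                 ConstantCopy (structure Q) χ
        select (ys , η , hom) = (λ v → to h (ys , v)) , (λ e → to-hom h (lift e)) , η , constant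
          where
          p : V → Fin N
          p = partAlong ys

          distinct : ∀ {d u v} → R A d u v → p u ≢ p v
          distinct {_} {u} {v} e eq with Fin.<-cmp (encode F u) (encode F v)
          ... | tri< lt _ _ = proj₁ (hom _ _ lt) eq
          ... | tri≈ _ same _ = R-irr A (subst (R A _ u) (sym (encode-injective F same)) e)
          ... | tri> _ _ gt = proj₁ (hom _ _ gt) (sym eq)

          lift : ∀ {d u v} → R A d u v → R (structure allCopies) d (ys , u) (ys , v)
          lift e = refl , distinct e , e

          ascending : ∀ {u v} → encode F u Fin.< encode F v → R A c u v → χ (to h (ys , u)) (to h (ys , v)) ≡ η
          ascending {u} {v} lt e =
            trans (proj₂ (between (p u) (p v)) refl refl (lift e)) (proj₂ (hom _ _ lt))

          constant : ∀ {u v} → R A c u v → χ (to h (ys , u)) (to h (ys , v)) ≡ η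
          constant {u} {v} e with Fin.<-cmp (encode F u) (encode F v)
          ... | tri< lt _ _ = ascending lt e
          ... | tri≈ _ same _ = contradiction (cong (lookup ys) same) (distinct e)
          -- A descending edge is reversed by the symmetry of `χ`.
          ... | tri> _ _ gt = trans (χ-sym _ _) (ascending gt (R-sym A e))

  ColourCopy : ∀ {V W} → Structure V → Structure W → (W → W → Colour) → Set
  ColourCopy {V} {W} A B χ = Σ (V → W) λ g → Hom A B g × Σ (Colour → Colour) λ η →
    ∀ d {u v} → R A d u v → χ (g u) (g v) ≡ η d

  TwoColourRamsey : ∀ {V} → Structure V → Set₁
  TwoColourRamsey A = Σ Set λ W → Finite W × Σ (Structure W) λ B →
    (χ : W → W → Colour) → (∀ u v → χ u v ≡ χ v u) → ColourCopy A B χ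

  -- First a copy of `B₁` in `B₂` whose blue edges agree, then a copy of `A` in it whose red edges
  -- agree; its blue edges are blue edges of `B₁` and still agree.
  twoColourRamsey : ∀ {V} → Finite V → (A : Structure V) → TwoColourRamsey A
  twoColourRamsey {V} F A with edgeRamsey F A red
  ... | W₁ , F₁ , B₁ , arrow₁ with edgeRamsey F₁ B₁ blue
  ...   | W₂ , F₂ , B₂ , arrow₂ = W₂ , F₂ , B₂ , result
    where
    result : (χ : W₂ → W₂ → Colour) → (∀ u v → χ u v ≡ χ v u) → ColourCopy A B₂ χ
    result χ χ-sym with arrow₂ χ χ-sym
    ... | h , h-hom , ηᵇ , h-blue with arrow₁ (λ u v → χ (h u) (h v)) (λ u v → χ-sym (h u) (h v))
    ...   | g , g-hom , ηʳ , g-red = h ∘ g , (λ e → h-hom (g-hom e)) ,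
      (λ { red → ηʳ ; blue → ηᵇ }) , λ { red e → g-red e ; blue e → h-blue (g-hom e) }

  -- The seed

  Clique : ∀ {s} → (Fin s → Fin s → Colour) → Colour → (Fin k → Fin s) → Set
  Clique χ d f = ∀ i j → i ≢ j → f i ≢ f j × χ (f i) (f j) ≡ d

  complete : ∀ {s} (χ : Fin s → Fin s → Colour) → (∀ i j → χ i j ≡ χ j i) →
    (∀ d f → ¬ Clique χ d f) → Structure (Fin s)
  complete χ χ-sym free = record
    { R = λ d u v → u ≢ v × χ u v ≡ d
    ; R? = λ d u v → ¬? (u Fin.≟ v) ×-dec (χ u v ≟ᶜ d)
    ; R-sym = λ (ne , eq) → ne ∘ sym , trans (χ-sym _ _) eq
    ; R-irr = λ (ne , _) → ne refl
    ; R-unique = λ (_ , eq) (_ , eq′) → trans (sym eq) eq′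
    ; clique-free = free }

  monochromatic : Colour → Structure (Fin (suc (suc κ)))
  monochromatic c = complete (λ _ _ → c) (λ _ _ → refl) free
    where
    free : ∀ d f → ¬ Clique (λ _ _ → c) d f
    free d f cl with pigeonhole (n<1+n _) f
    ... | i , j , i<j , eq = proj₁ (cl i j (Fin.<⇒≢ i<j)) eq

  -- `disjointUnion` asks for one vertex set, so each component is a blow-up that depends on one
  -- coordinate only.
  seed : ∀ {s} → Structure (Fin s) → Structure (Maybe Colour × (Fin s × Fin (suc (suc κ))))
  seed A = disjointUnion (Maybe-finite Colour-finite) λ where
    nothing  → pullback proj₁ A
    (just c) → pullback proj₂ (monochromatic c)

  injective : ∀ {a s} (f : Fin a → Fin s) → (∀ i j → i ≢ j → f i ≢ f j) → ∀ {i j} → f i ≡ f j → i ≡ j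
  injective f distinct {i} {j} eq with i Fin.≟ j
  ... | yes i≡j = i≡j
  ... | no i≢j  = contradiction eq (distinct i j i≢j)

  -- A vector instead of a function, so that the search for a clique is over a finite type.
  HasClique : ∀ {s} → (Fin s → Fin s → Colour) → Colour → Set
  HasClique {s} χ d = Σ (Vec (Fin s) k) λ v → Clique χ d (lookup v)

  hasClique? : ∀ {s} χ d → Dec (HasClique {s} χ d)
  hasClique? {s} χ d = ∃? (Vec-finite (Fin-finite s) k) λ v →
    all? λ i → all? λ j → ¬? (i Fin.≟ j) →-dec
      (¬? (lookup v i Fin.≟ lookup v j) ×-dec (χ (lookup v i) (lookup v j) ≟ᶜ d))

  hasClique : ∀ {s} (χ : Fin s → Fin s → Colour) {d} f → Clique χ d f → HasClique χ d
  hasClique χ {d} f cl = tabulate f , λ i j i≢j →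
    subst₂ (λ u v → u ≢ v × χ u v ≡ d) (sym (lookup∘tabulate f i)) (sym (lookup∘tabulate f j)) (cl i j i≢j)

  Good : ∀ {s} → (Fin s → Fin s → Colour) → Set
  Good χ = (∀ i j → χ i j ≡ χ j i) × ¬ HasClique χ red × ¬ HasClique χ blue

  good? : ∀ {s} χ → Dec (Good {s} χ)
  good? χ = (all? λ i → all? λ j → χ i j ≟ᶜ χ j i) ×-dec ¬? (hasClique? χ red) ×-dec ¬? (hasClique? χ blue)

  Good-resp : ∀ {s} {χ χ′ : Fin s → Fin s → Colour} → (∀ i j → χ i j ≡ χ′ i j) → Good χ → Good χ′
  Good-resp {χ = χ} {χ′} eq (χ-sym , ¬red , ¬blue) =
    (λ i j → trans (sym (eq i j)) (trans (χ-sym i j) (eq j i))) , ¬red ∘ back , ¬blue ∘ back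
    where
    back : ∀ {d} → HasClique χ′ d → HasClique χ d
    back (v , cl) = v , λ i j i≢j → proj₁ (cl i j i≢j) , trans (eq _ _) (proj₂ (cl i j i≢j))

  -- A witness is extracted from a mere negation by exhaustive search: colour matrices form a finite
  -- type and `Good` is decidable.
  goodColouring : ∀ {s} → ¬ Arrows (K s) k k → ∃ (Good {s})
  goodColouring {s} ¬arrows with ∃? (Vec-finite (Vec-finite Colour-finite s) s) (λ M → good? (λ i j → lookup (lookup M i) j))
  ... | yes (M , good) = _ , good
  ... | no none = contradiction arrows ¬arrows
    where
    monoClique : ∀ (χ : Colouring (K s)) {d} → HasClique (col χ) d → MonoClique (K s) χ d k
    monoClique χ (v , cl) = lookup v , injective (lookup v) (λ i j i≢j → proj₁ (cl i j i≢j)) ,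
      λ i j i≢j → cong not (dec-false (lookup v i Fin.≟ lookup v j) (proj₁ (cl i j i≢j))) , proj₂ (cl i j i≢j)

    tabulated : ∀ (χ : Fin s → Fin s → Colour) i j →
      χ i j ≡ lookup (lookup (tabulate λ i → tabulate (χ i)) i) j
    tabulated χ i j = sym (trans (cong (λ row → lookup row j) (lookup∘tabulate (λ i → tabulate (χ i)) i))
                                 (lookup∘tabulate (χ i) j))

    arrows : Arrows (K s) k k
    arrows χ with hasClique? (col χ) red | hasClique? (col χ) blue
    ... | yes cl  | _        = inj₁ (monoClique χ cl)
    ... | no _    | yes cl   = inj₂ (monoClique χ cl)
    ... | no ¬red | no ¬blue =
      contradiction (tabulate (λ i → tabulate (col χ i)) , Good-resp (tabulated (col χ)) (colSym χ , ¬red , ¬blue)) none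

  -- From coloured structures to graphs

  module _ {n} (A : Structure (Fin n)) where

    isEdge : Colour → Fin n → Fin n → Bool
    isEdge d u v = does (R? A d u v)

    isEdge-sym : ∀ d u v → isEdge d u v ≡ isEdge d v u
    isEdge-sym d u v = does-⇔ (mk⇔ (R-sym A) (R-sym A)) (R? A d u v) (R? A d v u)

    graph : Graph n
    graph = record
      { adj = λ u v → isEdge red u v ∨ isEdge blue u v
      ; adjSym = λ u v → cong₂ _∨_ (isEdge-sym red u v) (isEdge-sym blue u v)
      ; adjIrr = λ v → cong₂ _∨_ (dec-false (R? A red v v) (R-irr A)) (dec-false (R? A blue v v) (R-irr A)) }

    adjacent : ∀ d {u v} → R A d u v → adj graph u v ≡ true
    adjacent red  {u} {v} e rewrite dec-true (R? A red u v) e = refl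
    adjacent blue {u} {v} e rewrite dec-true (R? A blue u v) e = ∨-zeroʳ _

    colouring : Colouring graph
    colouring = record
      -- Non-edges come out blue, but a clique only sees edges.
      { col = λ u v → if isEdge red u v then red else blue
      ; colSym = λ u v → cong (λ b → if b then red else blue) (isEdge-sym red u v) }

    coloured-edge : ∀ {d} u v → adj graph u v ≡ true → col colouring u v ≡ d → R A d u v
    coloured-edge u v eq eq′ with R? A red u v | R? A blue u v | eq | eq′
    ... | yes e | _     | _ | refl = e
    ... | no _  | yes e | _ | refl = e
    ... | no _  | no _  | () | _

    notArrows : NotArrows graph k k
    notArrows = colouring , free , free
      where
      free : ∀ {d} → ¬ MonoClique graph colouring d k
      free {d} (f , _ , cl) = clique-free A d f λ i j i≢j →
        coloured-edge (f i) (f j) (proj₁ (cl i j i≢j)) (proj₂ (cl i j i≢j))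

    monoClique : ∀ (χ : Colouring graph) {a c} (f : Fin a → Fin n) →
      (∀ i j → i ≢ j → ∃ λ d → R A d (f i) (f j) × col χ (f i) (f j) ≡ c) → MonoClique graph χ c a
    monoClique χ f edges =
      f ,
      injective f (λ i j i≢j eq → R-irr A (subst (R A _ (f i)) (sym eq) (proj₁ (proj₂ (edges i j i≢j))))) ,
      λ i j i≢j → let d , e , eq = edges i j i≢j in adjacent d e , eq

  module _ {V : Set} (F : Finite V) (A : Structure V) {a b : ℕ}
      (large : Fin a → V) (large-edge : ∀ i j → i ≢ j → ∃ λ d → R A d (large i) (large j))
      (small : Colour → Fin b → V) (small-edge : ∀ c i j → i ≢ j → R A c (small c i) (small c j)) where

    -- `small` has a clique in each original colour, because either one may be turned blue by `η`.
    -- `large` may mix colours, as it is used only when `η` is constantly red.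
    ramseyGraph : Σ ℕ λ n → Σ (Graph n) λ G → NotArrows G k k × Arrows G a b
    ramseyGraph = build (twoColourRamsey F A)
      where
      build : TwoColourRamsey A → Σ ℕ λ n → Σ (Graph n) λ G → NotArrows G k k × Arrows G a b
      build (W , F′ , B , arrow) = size F′ , graph C , notArrows C , arrows
        where
        C : Structure (Fin (size F′))
        -- Since `decode` may repeat elements, this is a blow-up of `B`; `encode` finds `B` inside
        -- it.
        C = pullback (decode F′) B

        arrows : Arrows (graph C) a b
        arrows χ with arrow (λ u v → col χ (encode F′ u) (encode F′ v)) (λ u v → colSym χ _ _)
        ... | g , g-hom , η , η-colour = conclude (η red) (η blue) refl refl
          where
          h : V → Fin (size F′)
          h v = encode F′ (g v)

          h-edge : ∀ {d u v} → R A d u v → R C d (h u) (h v)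
          h-edge {d} {u} {v} e =
            subst₂ (R B d) (sym (decode-encode F′ (g u))) (sym (decode-encode F′ (g v))) (g-hom e)

          image : ∀ {m c} (f : Fin m → V) → (∀ i j → i ≢ j → ∃ λ d → R A d (f i) (f j) × η d ≡ c) →
            MonoClique (graph C) χ c m
          image f edges = monoClique C χ (h ∘ f) λ i j i≢j →
            let d , e , eq = edges i j i≢j in d , h-edge e , trans (η-colour d e) eq

          small-blue : ∀ c → η c ≡ blue → MonoClique (graph C) χ blue b
          small-blue c eq = image (small c) λ i j i≢j → c , small-edge c i j i≢j , eq

          conclude : ∀ r b′ → η red ≡ r → η blue ≡ b′ →
            MonoClique (graph C) χ red a ⊎ MonoClique (graph C) χ blue b
          conclude blue _    eqʳ eqᵇ = inj₂ (small-blue red eqʳ)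
          conclude red  blue eqʳ eqᵇ = inj₂ (small-blue blue eqᵇ)
          conclude red  red  eqʳ eqᵇ = inj₁ (image large λ i j i≢j →
            let d , e = large-edge i j i≢j in d , e , all-red d)
            where
            all-red : ∀ d → η d ≡ red
            all-red red  = eqʳ
            all-red blue = eqᵇ

  criticalGraph : ∀ {s} → ¬ Arrows (K (suc s)) k k →
    Σ ℕ λ n → Σ (Graph n) λ G → NotArrows G k k × Arrows G (suc s) (suc (suc κ))
  criticalGraph ¬arrows with goodColouring ¬arrows
  ... | ψ , ψ-sym , ¬red , ¬blue = ramseyGraph
      (×-finite (Maybe-finite Colour-finite) (×-finite (Fin-finite _) (Fin-finite _)))
      (seed (complete ψ ψ-sym ψ-free))
      -- The coordinate that a component ignores is set to `zero`; `suc s` vertices make this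
      -- possible for the small cliques.
      (λ i → nothing , i , zero) (λ i j i≢j → ψ i j , refl , i≢j , refl)
      (λ c i → just c , zero , i) (λ c i j i≢j → refl , i≢j , refl)
    where
    ψ-free : ∀ d f → ¬ Clique ψ d f
    ψ-free red  f cl = ¬red (hasClique ψ f cl)
    ψ-free blue f cl = ¬blue (hasClique ψ f cl)

-- This excludes Ramsey numbers 0 and 1, so that `r ∸ 1` is positive.
¬Arrows-small : ∀ {r k} → r < k → ¬ Arrows (K r) k k
¬Arrows-small {r} {k} r<k arrows =
  [ absurd χ red , absurd χ blue ] (arrows χ)
  where
  χ : Colouring (K r)
  χ = record { col = λ _ _ → red ; colSym = λ _ _ → refl }

  absurd : ∀ χ d → ¬ MonoClique (K r) χ d k
  absurd _ _ (f , f-injective , _) with pigeonhole r<k f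
  ... | i , j , i<j , eq = Fin.<⇒≢ i<j (f-injective eq)

theorem1p2 : ∀ (k : ℕ) → 3 ≤ k → ∀ (r : ℕ) → IsRamseyNumber k r →
    Σ ℕ λ n → Σ (Graph n) λ G →
    NotArrows G k k × Arrows G (r ∸ 1) (k ∸ 1)
-- Minimality at `suc s`, which is `r ∸ 1`, provides the critical colouring for the seed.
theorem1p2 (suc (suc (suc κ))) (s≤s (s≤s (s≤s z≤n))) (suc (suc s)) (_ , minimal) =
  criticalGraph κ (minimal (suc s) (n<1+n (suc s)))
theorem1p2 (suc (suc (suc κ))) (s≤s (s≤s (s≤s z≤n))) zero (arrows , _) =
  contradiction arrows (¬Arrows-small (s≤s z≤n))
theorem1p2 (suc (suc (suc κ))) (s≤s (s≤s (s≤s z≤n))) (suc zero) (arrows , _) =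
  contradiction arrows (¬Arrows-small (s≤s (s≤s z≤n)))
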